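{- Let $\lambda$ be an infinite cardinal and let $\mathcal{K}$ be a structure-class such that $\mathcal{K}_\lambda$ is a subcanonical AP class. Then the following are equivalent: (1) $\mathcal{K}_\lambda$ has the maximal extension property. (2) The sheaf topos $\mathrm{Sh}(\mathcal{K}_\lambda^{\mathrm{op}},J_{\mathrm{at}})$ satisfies the internal axiom of choice.
   Context: A structure-class is a category $\mathcal{K}$ with a faithful functor $|-|:\mathcal{K}\to\mathbf{Set}$ such that: (i) for each morphism $f$, $|f|$ is injective; (ii) if $|f|$ is a bijection then $f$ is an isomorphism; (iii) (transportability) for each object $A$ and bijection $\sigma:|A|\to X$ there is an isomorphism $\bar\sigma:A\to A^\sigma$ in $\mathcal{K}$ with $|A^\sigma|=X$, $|\bar\sigma|=\sigma$; (iv) for each set $X$ the objects $A$ with $|A|=X$ form a set. Objects are called structures and morphisms embeddings. $\mathcal{K}_\lambda$ is the full subcategory of structures whose carrier has cardinality at most $\lambda$; it is essentially small, and (pre)sheaves on $\mathcal{K}_\lambda^{\mathrm{op}}$ are taken over an equivalent small category. Amalgamation property (AP) of $\mathcal{K}_\lambda$: for all $f:A\to B$, $g:A\to C$ in $\mathcal{K}_\lambda$ there are $h:B\to D$, $k:C\to D$ in $\mathcal{K}_\lambda$ with $hf=kg$. Coherence axiom: for all morphisms $g:A\to C$, $h:B\to C$ and every function $f:|A|\to|B|$ with $|g|=|h|\circ f$ there is a morphism $\bar f:A\to B$ with $|\bar f|=f$. The atomic topology $J_{\mathrm{at}}$ on $\mathcal{K}_\lambda^{\mathrm{op}}$ is the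 Grothendieck topology whose covering families are exactly the nonempty families. It is subcanonical if every representable presheaf is a sheaf. $\mathcal{K}_\lambda$ is a subcanonical AP class if it satisfies the coherence axiom and the AP, and $J_{\mathrm{at}}$ on $\mathcal{K}_\lambda^{\mathrm{op}}$ is subcanonical. A structure $M\in\mathcal{K}_\lambda$ is maximal (in $\mathcal{K}_\lambda$) if every embedding $M\to B$ in $\mathcal{K}_\lambda$ is an isomorphism. $\mathcal{K}_\lambda$ has the maximal extension property if for every $A\in\mathcal{K}_\lambda$ there is an embedding $A\to M$ in $\mathcal{K}_\lambda$ with $M$ maximal in $\mathcal{K}_\lambda$. A topos satisfies the internal axiom of choice if for every epimorphism $g:X\to Y$ and every object $Z$, $g^Z:X^Z\to Y^Z$ is an epimorphism. -}

module Defs where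

open import Axiom.ExcludedMiddle using (ExcludedMiddle)
open import Axiom.Extensionality.Propositional using (Extensionality; implicit-extensionality)
open import Axiom.UniquenessOfIdentityProofs.WithK using (uip)
open import Data.Bool using (Bool; true; T)
open import Data.Bool.Properties using (T-irrelevant)
open import Data.Irrelevant using ([_])
open import Data.Nat using (ℕ)
open import Data.Product using (Σ; ∃; ∃!; _×_; _,_; proj₁; proj₂)
open import Data.Refinement using (Refinement; value; _,_)
open import Function.Base using () renaming (id to idᶠ; _∘_ to _∘ᶠ_)
open import Function.Bundles using (_↣_; _⤖_; _↔_; _⇔_; mk↣; mk⤖; mk⇔; Injection; Bijection; Inverse)
open import Function.Definitions using (Injective; Bijective)
open import Level using (Level; Setω; _⊔_; suc)
open import Relation.Binary.PropositionalEquality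
  using (_≡_; refl; sym; trans; cong; cong₂; subst; module ≡-Reasoning)
open import Relation.Nullary.Decidable using (isYes; toWitness; fromWitness; recompute)

private
  variable
    o h o′ h′ ℓ : Level

-- The ambient theory is classical set theory with choice. As `ExcludedMiddle`
-- decides arbitrary types, and not only propositions, `em` returns an actual
-- element of every type that is not empty, and so subsumes the axiom of choice.

FunExt : Setω
FunExt = ∀ {a b} → Extensionality a b

record Classical : Setω where
  field
    em  : ∀ {a} → ExcludedMiddle a
    ext : FunExt

record Category (o h : Level) : Set (suc (o ⊔ h)) where
  infixr 9 _∘_
  field
    Obj       : Set o
    Hom       : Obj → Obj → Set h
    id        : ∀ {A} → Hom A A
    _∘_       : ∀ {A B C} → Hom B C → Hom A B → Hom A C
    identityˡ : ∀ {A B} (f : Hom A B) → id ∘ f ≡ f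
    identityʳ : ∀ {A B} (f : Hom A B) → f ∘ id ≡ f
    assoc     : ∀ {A B C D} (h : Hom C D) (g : Hom B C) (f : Hom A B) →
                (h ∘ g) ∘ f ≡ h ∘ (g ∘ f)

op : Category o h → Category o h
op C = record
  { Obj       = Obj
  ; Hom       = λ A B → Hom B A
  ; id        = id
  ; _∘_       = λ f g → g ∘ f
  ; identityˡ = identityʳ
  ; identityʳ = identityˡ
  ; assoc     = λ h g f → sym (assoc f g h)
  }
  where open Category C

Sets : (ℓ : Level) → Category (suc ℓ) ℓ
Sets ℓ = record
  { Obj       = Set ℓ
  ; Hom       = λ A B → A → B
  ; id        = idᶠ
  ; _∘_       = λ g f → g ∘ᶠ f
  ; identityˡ = λ _ → refl
  ; identityʳ = λ _ → refl
  ; assoc     = λ _ _ _ → refl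
  }

FullSubcategory : ∀ {i} (C : Category o h) {I : Set i} → (I → Category.Obj C) → Category i h
FullSubcategory C {I} ι = record
  { Obj       = I
  ; Hom       = λ i j → Hom (ι i) (ι j)
  ; id        = id
  ; _∘_       = _∘_
  ; identityˡ = identityˡ
  ; identityʳ = identityʳ
  ; assoc     = assoc
  }
  where open Category C

module _ (C : Category o h) where
  open Category C

  IsIso : ∀ {A B} → Hom A B → Set h
  IsIso {A} {B} f = Σ (Hom B A) λ g → (g ∘ f ≡ id) × (f ∘ g ≡ id)

  Iso : Obj → Obj → Set h
  Iso A B = Σ (Hom A B) IsIso

  Epi : ∀ {A B} → Hom A B → Set (o ⊔ h)
  Epi {A} {B} g = ∀ {D} (u v : Hom B D) → u ∘ g ≡ v ∘ g → u ≡ v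

  IsMaximal : Obj → Set (o ⊔ h)
  IsMaximal M = ∀ {B} (f : Hom M B) → IsIso f

  MaximalExtensionProperty : Set (o ⊔ h)
  MaximalExtensionProperty = ∀ A → Σ Obj λ M → Hom A M × IsMaximal M

  AmalgamationProperty : Set (o ⊔ h)
  AmalgamationProperty =
    ∀ {A B C} (f : Hom A B) (g : Hom A C) →
    Σ Obj λ D → Σ (Hom B D) λ p → Σ (Hom C D) λ q → p ∘ f ≡ q ∘ g

record Functor (C : Category o h) (D : Category o′ h′) : Set (o ⊔ h ⊔ o′ ⊔ h′) where
  private
    module C = Category C
    module D = Category D
  field
    F₀           : C.Obj → D.Obj
    F₁           : ∀ {A B} → C.Hom A B → D.Hom (F₀ A) (F₀ B)
    identity     : ∀ {A} → F₁ (C.id {A}) ≡ D.id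
    homomorphism : ∀ {A B E} (g : C.Hom B E) (f : C.Hom A B) → F₁ (g C.∘ f) ≡ F₁ g D.∘ F₁ f

record NatTrans {C : Category o h} {D : Category o′ h′} (F G : Functor C D) :
                Set (o ⊔ h ⊔ h′) where
  private
    module C = Category C
    module D = Category D
    module F = Functor F
    module G = Functor G
  field
    η       : ∀ A → D.Hom (F.F₀ A) (G.F₀ A)
    commute : ∀ {A B} (f : C.Hom A B) → η B D.∘ F.F₁ f ≡ G.F₁ f D.∘ η A

record IsEquivalence {C : Category o h} {D : Category o′ h′} (F : Functor C D) :
                     Set (o ⊔ h ⊔ o′ ⊔ h′) where
  open Functor F
  field
    fullyFaithful         : ∀ {A B} → Bijective _≡_ _≡_ (F₁ {A} {B})
    essentiallySurjective : ∀ X → Σ (Category.Obj C) λ A → Iso D (F₀ A) X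

record SmallModel (D : Category o ℓ) : Set (o ⊔ suc ℓ) where
  field
    small         : Category ℓ ℓ
    inclusion     : Functor small D
    isEquivalence : IsEquivalence inclusion

record BinaryProducts (C : Category o h) : Set (o ⊔ h) where
  open Category C
  infixr 7 _⊗_
  field
    _⊗_      : Obj → Obj → Obj
    π₁       : ∀ {A B} → Hom (A ⊗ B) A
    π₂       : ∀ {A B} → Hom (A ⊗ B) B
    ⟨_,_⟩    : ∀ {A B W} → Hom W A → Hom W B → Hom W (A ⊗ B)
    project₁ : ∀ {A B W} (f : Hom W A) (g : Hom W B) → π₁ ∘ ⟨ f , g ⟩ ≡ f
    project₂ : ∀ {A B W} (f : Hom W A) (g : Hom W B) → π₂ ∘ ⟨ f , g ⟩ ≡ g
    unique   : ∀ {A B W} (k : Hom W (A ⊗ B)) → ⟨ π₁ ∘ k , π₂ ∘ k ⟩ ≡ k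

record Exponentials (C : Category o h) (P : BinaryProducts C) : Set (o ⊔ h) where
  open Category C
  open BinaryProducts P using (_⊗_; π₁; π₂; ⟨_,_⟩)
  infixr 8 _^_
  field
    _^_          : Obj → Obj → Obj
    eval         : ∀ {X Z} → Hom ((X ^ Z) ⊗ Z) X
    curry        : ∀ {W X Z} → Hom (W ⊗ Z) X → Hom W (X ^ Z)
    curry-β      : ∀ {W X Z} (f : Hom (W ⊗ Z) X) → eval ∘ ⟨ curry f ∘ π₁ , π₂ ⟩ ≡ f
    curry-unique : ∀ {W X Z} (k : Hom W (X ^ Z)) → curry (eval ∘ ⟨ k ∘ π₁ , π₂ ⟩) ≡ k

  _^₁_ : ∀ {X Y} → Hom X Y → (Z : Obj) → Hom (X ^ Z) (Y ^ Z)
  g ^₁ Z = curry (g ∘ eval)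

InternalAxiomOfChoice : (C : Category o h) (P : BinaryProducts C) → Exponentials C P → Set (o ⊔ h)
InternalAxiomOfChoice C P E =
  ∀ {X Y} (g : Hom X Y) → Epi C g → ∀ Z → Epi C (g ^₁ Z)
  where
  open Category C
  open Exponentials E

module _ (S : Category o ℓ) where
  open Category S

  record Sieve (c : Obj) : Set (o ⊔ suc ℓ) where
    field
      arrows : ∀ {d} → Hom d c → Set ℓ
      closed : ∀ {d e} {f : Hom d c} (g : Hom e d) → arrows f → arrows (f ∘ g)

  pullbackSieve : ∀ {c d} → Hom d c → Sieve c → Sieve d
  pullbackSieve k R = record
    { arrows = λ f → arrows (k ∘ f)
    ; closed = λ {_} {_} {f} g p → subst arrows (assoc k f g) (closed g p)
    }
    where open Sieve R

  record Family (c : Obj) : Set (o ⊔ suc ℓ) where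
    field
      Index  : Set ℓ
      source : Index → Obj
      arrow  : ∀ i → Hom (source i) c

  generatedSieve : ∀ {c} → Family c → Sieve c
  generatedSieve F = record
    { arrows = λ f → Σ Index λ i → ∃ λ g → f ≡ arrow i ∘ g
    ; closed = λ { g (i , k , refl) → i , k ∘ g , assoc (arrow i) k g }
    }
    where open Family F

  -- A sieve is maximal exactly when it contains the identity. Saying it this
  -- way makes covering independent of how membership in the sieve is presented.

  record GrothendieckTopology : Set (suc (o ⊔ ℓ)) where
    field
      Covers       : ∀ {c} → Sieve c → Set (o ⊔ ℓ)
      maximality   : ∀ {c} (R : Sieve c) → Sieve.arrows R id → Covers R
      stability    : ∀ {c d} (R : Sieve c) → Covers R → (k : Hom d c) → Covers (pullbackSieve k R)
      transitivity : ∀ {c} (R Q : Sieve c) → Covers R →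
                     (∀ {d} (f : Hom d c) → Sieve.arrows R f → Covers (pullbackSieve f Q)) →
                     Covers Q

    IsCoveringFamily : ∀ {c} → Family c → Set (o ⊔ ℓ)
    IsCoveringFamily F = Covers (generatedSieve F)

  Presheaf : Set (o ⊔ suc ℓ)
  Presheaf = Functor (op S) (Sets ℓ)

  -- The membership proof q of f ∘ g is arbitrary; taking g = id shows that the
  -- sections do not depend on membership proofs.

  record MatchingFamily (P : Presheaf) {c : Obj} (R : Sieve c) : Set (o ⊔ ℓ) where
    open Functor P
    open Sieve R
    field
      section    : ∀ {d} (f : Hom d c) → arrows f → F₀ d
      compatible : ∀ {d e} (f : Hom d c) (p : arrows f) (g : Hom e d) (q : arrows (f ∘ g)) →
                   section (f ∘ g) q ≡ F₁ g (section f p)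

  IsAmalgamation : (P : Presheaf) {c : Obj} {R : Sieve c} →
                   MatchingFamily P R → Functor.F₀ P c → Set (o ⊔ ℓ)
  IsAmalgamation P {c} {R} m a =
    ∀ {d} (f : Hom d c) (p : Sieve.arrows R f) → Functor.F₁ P f a ≡ MatchingFamily.section m f p

  representable : FunExt → Obj → Presheaf
  representable ext c = record
    { F₀           = λ d → Hom d c
    ; F₁           = λ g f → f ∘ g
    ; identity     = ext identityʳ
    ; homomorphism = λ g f → ext λ k → sym (assoc k f g)
    }

  module _ (J : GrothendieckTopology) where
    open GrothendieckTopology J

    IsSheaf : Presheaf → Set (o ⊔ suc ℓ)
    IsSheaf P = ∀ {c} (R : Sieve c) → Covers R → (m : MatchingFamily P R) →
                ∃! _≡_ (IsAmalgamation P m)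

    Subcanonical : FunExt → Set (o ⊔ suc ℓ)
    Subcanonical ext = ∀ c → IsSheaf (representable ext c)

    record Sheaf : Set (o ⊔ suc ℓ) where
      constructor sheaf
      field
        presheaf : Presheaf
        isSheaf  : IsSheaf presheaf

module _ {C : Category o h} {D : Category o′ h′} {F G : Functor C D} (ext : FunExt) where
  private
    module F = Functor F
    module G = Functor G
    module C = Category C
    module D = Category D
  open NatTrans

  NatTrans-≡ : {α β : NatTrans F G} → (∀ A → η α A ≡ η β A) → α ≡ β
  NatTrans-≡ {α} {β} p = lemma (ext p) (commute α) (commute β)
    where
    lemma : {η₁ η₂ : ∀ A → D.Hom (F.F₀ A) (G.F₀ A)} → η₁ ≡ η₂ →
            (c₁ : ∀ {A B} (f : C.Hom A B) → η₁ B D.∘ F.F₁ f ≡ G.F₁ f D.∘ η₁ A) →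
            (c₂ : ∀ {A B} (f : C.Hom A B) → η₂ B D.∘ F.F₁ f ≡ G.F₁ f D.∘ η₂ A) →
            _≡_ {A = NatTrans F G} (record { η = η₁ ; commute = c₁ }) (record { η = η₂ ; commute = c₂ })
    lemma {η₁} refl c₁ c₂ = cong mk
      (implicit-extensionality ext λ {A} → implicit-extensionality ext λ {B} → ext λ f →
        uip (c₁ {A} {B} f) (c₂ {A} {B} f))
      where
      mk : (∀ {A B} (f : C.Hom A B) → η₁ B D.∘ F.F₁ f ≡ G.F₁ f D.∘ η₁ A) → NatTrans F G
      mk c = record { η = η₁ ; commute = c }

private
  app : ∀ {a b} {A : Set a} {B : A → Set b} {f g : ∀ x → B x} → f ≡ g → ∀ x → f x ≡ g x
  app refl _ = refl

module SheafTopos (ext : FunExt) (S : Category ℓ ℓ) (J : GrothendieckTopology S) where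
  open Category S
  open GrothendieckTopology J
  open NatTrans
  open Sheaf

  Sh : Category (suc ℓ) ℓ
  Sh = record
    { Obj       = Sheaf S J
    ; Hom       = λ X Y → NatTrans (presheaf X) (presheaf Y)
    ; id        = record { η = λ _ x → x ; commute = λ _ → refl }
    ; _∘_       = λ β α → record
        { η       = λ c x → η β c (η α c x)
        ; commute = λ f → ext λ x →
            trans (cong (η β _) (app (commute α f) x)) (app (commute β f) (η α _ x))
        }
    ; identityˡ = λ _ → NatTrans-≡ ext λ _ → refl
    ; identityʳ = λ _ → NatTrans-≡ ext λ _ → refl
    ; assoc     = λ _ _ _ → NatTrans-≡ ext λ _ → refl
    }

  productPresheaf : Presheaf S → Presheaf S → Presheaf S
  productPresheaf X Y = record
    { F₀           = λ c → X.F₀ c × Y.F₀ c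
    ; F₁           = λ { f (x , y) → X.F₁ f x , Y.F₁ f y }
    ; identity     = ext λ { (x , y) → cong₂ _,_ (app X.identity x) (app Y.identity y) }
    ; homomorphism = λ g f → ext λ { (x , y) →
        cong₂ _,_ (app (X.homomorphism g f) x) (app (Y.homomorphism g f) y) }
    }
    where
    module X = Functor X
    module Y = Functor Y

  private
    ,-injective : ∀ {a b} {A : Set a} {B : Set b} {x x′ : A} {y y′ : B} →
                  _≡_ {A = A × B} (x , y) (x′ , y′) → (x ≡ x′) × (y ≡ y′)
    ,-injective refl = refl , refl

    productIsSheaf : (X Y : Sheaf S J) → IsSheaf S J (productPresheaf (presheaf X) (presheaf Y))
    productIsSheaf X Y {c} R cov m =
      let (x , px , ux) = isSheaf X R cov m₁
          (y , py , uy) = isSheaf Y R cov m₂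
      in (x , y) ,
         (λ f p → cong₂ _,_ (px f p) (py f p)) ,
         (λ q → cong₂ _,_ (ux λ f p → cong proj₁ (q f p)) (uy λ f p → cong proj₂ (q f p)))
      where
      open MatchingFamily m
      m₁ : MatchingFamily S (presheaf X) R
      m₁ = record { section    = λ f p → proj₁ (section f p)
                  ; compatible = λ f p g q → cong proj₁ (compatible f p g q) }
      m₂ : MatchingFamily S (presheaf Y) R
      m₂ = record { section    = λ f p → proj₂ (section f p)
                  ; compatible = λ f p g q → cong proj₂ (compatible f p g q) }

  products : BinaryProducts Sh
  products = record
    { _⊗_      = λ X Y → sheaf (productPresheaf (presheaf X) (presheaf Y)) (productIsSheaf X Y)
    ; π₁       = record { η = λ _ → proj₁ ; commute = λ _ → refl }
    ; π₂       = record { η = λ _ → proj₂ ; commute = λ _ → refl }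
    ; ⟨_,_⟩    = λ α β → record
        { η       = λ c w → η α c w , η β c w
        ; commute = λ f → ext λ w → cong₂ _,_ (app (commute α f) w) (app (commute β f) w)
        }
    ; project₁ = λ _ _ → NatTrans-≡ ext λ _ → refl
    ; project₂ = λ _ _ → NatTrans-≡ ext λ _ → refl
    ; unique   = λ _ → NatTrans-≡ ext λ _ → refl
    }

  private
    y : Obj → Presheaf S
    y = representable S ext

  exponentialPresheaf : Presheaf S → Presheaf S → Presheaf S
  exponentialPresheaf X Z = record
    { F₀           = λ c → NatTrans (productPresheaf (y c) Z) X
    ; F₁           = λ u φ → record
        { η       = λ { d (f , z) → η φ d (u ∘ f , z) }
        ; commute = λ g → ext λ { (f , z) →
            trans (cong (λ k → η φ _ (k , Functor.F₁ Z g z)) (sym (assoc u f g)))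
                  (app (commute φ g) (u ∘ f , z)) }
        }
    ; identity     = ext λ φ → NatTrans-≡ ext λ d → ext λ { (f , z) →
        cong (λ k → η φ d (k , z)) (identityˡ f) }
    ; homomorphism = λ g f → ext λ φ → NatTrans-≡ ext λ d → ext λ { (k , z) →
        cong (λ l → η φ d (l , z)) (assoc f g k) }
    }

  private
    module ExponentialIsSheaf (X : Sheaf S J) (Z : Presheaf S) {c : Obj} (R : Sieve S c)
             (cov : Covers R)
             (m : MatchingFamily S (exponentialPresheaf (presheaf X) Z) R) where
      module X = Functor (presheaf X)
      module Z = Functor Z
      open Sieve R
      open MatchingFamily m
      open ≡-Reasoning

      section-cong : ∀ {d} {f g : Hom d c} (p : arrows f) (q : arrows g) → f ≡ g →
                     section f p ≡ section g q
      section-cong {f = f} p q refl =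
        trans (sym (lemma (identityʳ f) p))
              (trans (compatible f q id (subst arrows (sym (identityʳ f)) p))
                     (app (Functor.identity (exponentialPresheaf (presheaf X) Z)) (section f q)))
        where
        lemma : ∀ {k} (e : k ≡ f) (p : arrows f) →
                section k (subst arrows (sym e) p) ≡ section f p
        lemma refl _ = refl

      restrict : ∀ {d e e′} {f : Hom d c} {g : Hom e d} {k : Hom e c} →
                 k ≡ f ∘ g → (p : arrows f) (q : arrows k) (l : Hom e′ e) (z : Z.F₀ e′) →
                 η (section k q) e′ (l , z) ≡ η (section f p) e′ (g ∘ l , z)
      restrict {f = f} {g = g} refl p q l z =
        cong (λ φ → η φ _ (l , z)) (compatible f p g q)

      glued : ∀ {e} (k : Hom e c) (z : Z.F₀ e) → MatchingFamily S (presheaf X) (pullbackSieve S k R)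
      glued k z = record
        { section    = λ f p → η (section (k ∘ f) p) _ (id , Z.F₁ f z)
        ; compatible = λ {_} {e} f p g q → begin
            η (section (k ∘ f ∘ g) q) e (id , Z.F₁ (f ∘ g) z)
              ≡⟨ restrict (sym (assoc k f g)) p q id _ ⟩
            η (section (k ∘ f) p) e (g ∘ id , Z.F₁ (f ∘ g) z)
              ≡⟨ cong₂ (λ l w → η (section (k ∘ f) p) e (l , w))
                   (trans (identityʳ g) (sym (identityˡ g))) (app (Z.homomorphism g f) z) ⟩
            η (section (k ∘ f) p) e (id ∘ g , Z.F₁ g (Z.F₁ f z))
              ≡⟨ app (commute (section (k ∘ f) p) g) (id , Z.F₁ f z) ⟩
            X.F₁ g (η (section (k ∘ f) p) _ (id , Z.F₁ f z)) ∎
        }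

      cov′ : ∀ {e} (k : Hom e c) → Covers (pullbackSieve S k R)
      cov′ = stability R cov

      value′ : ∀ {e} (k : Hom e c) (z : Z.F₀ e) → X.F₀ e
      value′ k z = proj₁ (isSheaf X _ (cov′ k) (glued k z))

      value-restrict : ∀ {e} (k : Hom e c) (z : Z.F₀ e) →
                       IsAmalgamation S (presheaf X) (glued k z) (value′ k z)
      value-restrict k z = proj₁ (proj₂ (isSheaf X _ (cov′ k) (glued k z)))

      value-unique : ∀ {e} (k : Hom e c) (z : Z.F₀ e) {x : X.F₀ e} →
                     IsAmalgamation S (presheaf X) (glued k z) x → value′ k z ≡ x
      value-unique k z = proj₂ (proj₂ (isSheaf X _ (cov′ k) (glued k z)))

      amalgam : NatTrans (productPresheaf (y c) Z) (presheaf X)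
      amalgam = record
        { η       = λ { e (k , z) → value′ k z }
        ; commute = λ u → ext λ { (k , z) → value-unique (k ∘ u) (Z.F₁ u z) λ f p →
            let p′ = subst arrows (assoc k u f) p in begin
            X.F₁ f (X.F₁ u (value′ k z))
              ≡⟨ app (X.homomorphism f u) (value′ k z) ⟨
            X.F₁ (u ∘ f) (value′ k z)
              ≡⟨ value-restrict k z (u ∘ f) p′ ⟩
            η (section (k ∘ u ∘ f) p′) _ (id , Z.F₁ (u ∘ f) z)
              ≡⟨ cong₂ (λ φ w → η φ _ (id , w)) (section-cong p′ p (sym (assoc k u f)))
                   (app (Z.homomorphism f u) z) ⟩
            η (section ((k ∘ u) ∘ f) p) _ (id , Z.F₁ f (Z.F₁ u z)) ∎ }
        }

      isAmalgamation : IsAmalgamation S (exponentialPresheaf (presheaf X) Z) m amalgam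
      isAmalgamation f p = NatTrans-≡ ext λ e → ext λ { (g , z) → value-unique (f ∘ g) z λ k q →
        begin
        X.F₁ k (η (section f p) e (g , z))
          ≡⟨ app (commute (section f p) k) (g , z) ⟨
        η (section f p) _ (g ∘ k , Z.F₁ k z)
          ≡⟨ cong (λ l → η (section f p) _ (l , Z.F₁ k z)) (identityʳ (g ∘ k)) ⟨
        η (section f p) _ ((g ∘ k) ∘ id , Z.F₁ k z)
          ≡⟨ restrict (assoc f g k) p q id (Z.F₁ k z) ⟨
        η (section ((f ∘ g) ∘ k) q) _ (id , Z.F₁ k z) ∎ }

      isUnique : ∀ {β} → IsAmalgamation S (exponentialPresheaf (presheaf X) Z) m β → amalgam ≡ β
      isUnique {β} q = NatTrans-≡ ext λ e → ext λ { (k , z) → value-unique k z λ f p → begin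
        X.F₁ f (η β e (k , z))
          ≡⟨ app (commute β f) (k , z) ⟨
        η β _ (k ∘ f , Z.F₁ f z)
          ≡⟨ cong (λ l → η β _ (l , Z.F₁ f z)) (identityʳ (k ∘ f)) ⟨
        η β _ ((k ∘ f) ∘ id , Z.F₁ f z)
          ≡⟨ cong (λ φ → η φ _ (id , Z.F₁ f z)) (q (k ∘ f) p) ⟩
        η (section (k ∘ f) p) _ (id , Z.F₁ f z) ∎ }

    exponentialIsSheaf : (X : Sheaf S J) (Z : Presheaf S) →
                         IsSheaf S J (exponentialPresheaf (presheaf X) Z)
    exponentialIsSheaf X Z R cov m = amalgam , isAmalgamation , isUnique
      where open ExponentialIsSheaf X Z R cov m

  exponentials : Exponentials Sh products
  exponentials = record
    { _^_          = λ X Z → sheaf (exponentialPresheaf (presheaf X) (presheaf Z))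
                                   (exponentialIsSheaf X (presheaf Z))
    ; eval         = λ {X} {Z} → record
        { η       = λ { c (φ , z) → η φ c (id , z) }
        ; commute = λ f → ext λ { (φ , z) →
            trans (cong (λ k → η φ _ (k , Functor.F₁ (presheaf Z) f z))
                     (trans (identityʳ f) (sym (identityˡ f))))
                  (app (commute φ f) (id , z)) }
        }
    ; curry        = λ {W} {X} {Z} α → record
        { η       = λ c w → record
            { η       = λ { d (f , z) → η α d (Functor.F₁ (presheaf W) f w , z) }
            ; commute = λ g → ext λ { (f , z) →
                trans (cong (λ v → η α _ (v , Functor.F₁ (presheaf Z) g z))
                         (app (Functor.homomorphism (presheaf W) g f) w))
                      (app (commute α g) (Functor.F₁ (presheaf W) f w , z)) }
            }
        ; commute = λ u → ext λ w → NatTrans-≡ ext λ d → ext λ { (f , z) →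
            cong (λ v → η α d (v , z)) (sym (app (Functor.homomorphism (presheaf W) f u) w)) }
        }
    ; curry-β      = λ {W} α → NatTrans-≡ ext λ c → ext λ { (w , z) →
        cong (λ v → η α c (v , z)) (app (Functor.identity (presheaf W)) w) }
    ; curry-unique = λ {W} {X} {Z} κ → NatTrans-≡ ext λ c → ext λ w → NatTrans-≡ ext λ d →
        ext λ { (f , z) →
          trans (cong (λ φ → η φ d (id , z)) (app (commute κ f) w))
                (cong (λ k → η (η κ c w) d (k , z)) (identityʳ f)) }
    }

-- The site is op C: a sieve on c consists of arrows out of c in C, and the
-- stability axiom is the amalgamation property.

module _ (C : Category ℓ ℓ) (ap : AmalgamationProperty C) where
  open Category (op C)

  atomicTopology : GrothendieckTopology (op C)
  atomicTopology = record
    { Covers       = λ {c} R → ∃ λ d → Σ (Hom d c) (Sieve.arrows R)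
    ; maximality   = λ R p → _ , id , p
    ; stability    = λ { R (d , f , p) k →
        let (e , u , v , uf≡vk) = ap f k
        in e , v , subst (Sieve.arrows R) uf≡vk (Sieve.closed R u p) }
    ; transitivity = λ { R Q (d , f , p) cov → let (e , g , q) = cov f p in e , f ∘ g , q }
    }

  open GrothendieckTopology atomicTopology

  atomic-covering-families : ∀ {c} (F : Family (op C) c) → IsCoveringFamily F ⇔ Family.Index F
  atomic-covering-families F = mk⇔
    (λ { (_ , _ , i , _) → i })
    (λ i → _ , arrow i , i , id , sym (identityʳ (arrow i)))
    where open Family F

AP-small : {D : Category o ℓ} (E : SmallModel D) →
           AmalgamationProperty D → AmalgamationProperty (SmallModel.small E)
AP-small {D = D} E ap f g =
  let (X , p , q , pf≡qg) = ap (F₁ f) (F₁ g)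
      (d , i , j , ji≡id , ij≡id) = essentiallySurjective X
      (p′ , p′-eq) = full (j D.∘ p)
      (q′ , q′-eq) = full (j D.∘ q)
  in d , p′ , q′ , faithful (begin
       F₁ (p′ C.∘ f)      ≡⟨ homomorphism p′ f ⟩
       F₁ p′ D.∘ F₁ f     ≡⟨ cong (D._∘ F₁ f) p′-eq ⟩
       (j D.∘ p) D.∘ F₁ f ≡⟨ D.assoc j p (F₁ f) ⟩
       j D.∘ (p D.∘ F₁ f) ≡⟨ cong (j D.∘_) pf≡qg ⟩
       j D.∘ (q D.∘ F₁ g) ≡⟨ D.assoc j q (F₁ g) ⟨
       (j D.∘ q) D.∘ F₁ g ≡⟨ cong (D._∘ F₁ g) q′-eq ⟨
       F₁ q′ D.∘ F₁ g     ≡⟨ homomorphism q′ g ⟨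
       F₁ (q′ C.∘ g)      ∎)
  where
  open SmallModel E
  open Functor inclusion
  open IsEquivalence isEquivalence
  open ≡-Reasoning
  module C = Category small
  module D = Category D
  faithful : ∀ {A B} {f g : C.Hom A B} → F₁ f ≡ F₁ g → f ≡ g
  faithful = proj₁ fullyFaithful
  full : ∀ {A B} (k : D.Hom (F₀ A) (F₀ B)) → Σ (C.Hom A B) λ f → F₁ f ≡ k
  full k = let (f , e) = proj₂ fullyFaithful k in f , e refl

-- Set ℓ plays the role of the category of sets, and Set o that of the classes.
-- The equation |A^σ| = X is an equality of types, so comparing |σ̄| with σ
-- requires transport along it.

record StructureClass (o ℓ : Level) : Set (suc (o ⊔ ℓ)) where
  field
    category : Category o ℓ
    carrier  : Functor category (Sets ℓ)

  open Category category public

  ∣_∣ : Obj → Set ℓ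
  ∣_∣ = Functor.F₀ carrier

  ∣_∣₁ : ∀ {A B} → Hom A B → ∣ A ∣ → ∣ B ∣
  ∣_∣₁ = Functor.F₁ carrier

  field
    faithful      : ∀ {A B} {f g : Hom A B} → ∣ f ∣₁ ≡ ∣ g ∣₁ → f ≡ g
    injective     : ∀ {A B} (f : Hom A B) → Injective _≡_ _≡_ ∣ f ∣₁
    bijective⇒iso : ∀ {A B} (f : Hom A B) → Bijective _≡_ _≡_ ∣ f ∣₁ → IsIso category f
    transport     : ∀ A {X : Set ℓ} (σ : ∣ A ∣ ⤖ X) →
                    Σ Obj λ Aσ → Σ (Iso category A Aσ) λ σ̄ → Σ (∣ Aσ ∣ ≡ X) λ eq →
                    ∀ a → subst idᶠ eq (∣ proj₁ σ̄ ∣₁ a) ≡ Bijection.to σ a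
    fibre-small   : ∀ (X : Set ℓ) → Σ (Set ℓ) λ I → I ↔ Σ Obj λ A → ∣ A ∣ ≡ X

-- A cardinal is represented by any set Λ of that cardinality; Λ is infinite
-- when ℵ₀ is at most its cardinality.

Infinite : Set ℓ → Set ℓ
Infinite Λ = ℕ ↣ Λ

module _ (K : StructureClass o ℓ) (Λ : Set ℓ) where
  open StructureClass K

  -- The embedding into Λ is an irrelevant witness, so that a structure occurs
  -- once and not once for each embedding.

  BoundedStructure : Set (o ⊔ ℓ)
  BoundedStructure = Refinement Obj λ A → ∣ A ∣ ↣ Λ

  restriction : Category (o ⊔ ℓ) ℓ
  restriction = FullSubcategory category {BoundedStructure} value

  CoherenceAxiom : Set (o ⊔ ℓ)
  CoherenceAxiom =
    ∀ {A B C : BoundedStructure} (g : Hom (value A) (value C)) (k : Hom (value B) (value C))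
      (f : ∣ value A ∣ → ∣ value B ∣) → ∣ g ∣₁ ≡ ∣ k ∣₁ ∘ᶠ f →
    Σ (Hom (value A) (value B)) λ f̄ → ∣ f̄ ∣₁ ≡ f

  module _ (E : SmallModel restriction) where
    open SmallModel E

    record IsSubcanonicalAPClass (ext : FunExt) : Set (o ⊔ suc ℓ) where
      field
        coherence    : CoherenceAxiom
        amalgamation : AmalgamationProperty restriction

      J-at : GrothendieckTopology (op small)
      J-at = atomicTopology small (AP-small E λ {A} {B} {C} → amalgamation {A} {B} {C})

      field
        subcanonical : Subcanonical (op small) J-at ext

-- Essential smallness: the codes are subsets X of Λ together with a structure
-- on X.

module _ (cl : Classical) (K : StructureClass o ℓ) (Λ : Set ℓ) where
  open Classical cl
  open StructureClass K

  private
    Subset : (Λ → Bool) → Set ℓ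
    Subset χ = Σ Λ λ x → T (χ x)

    Subset-≡ : ∀ {χ} {s t : Subset χ} → proj₁ s ≡ proj₁ t → s ≡ t
    Subset-≡ {s = _ , p} {_ , q} refl = cong (_ ,_) (T-irrelevant p q)

    Code : Set ℓ
    Code = Σ (Λ → Bool) λ χ → proj₁ (fibre-small (Subset χ))

    decode : (χ : Λ → Bool) → proj₁ (fibre-small (Subset χ)) → Σ Obj λ A → ∣ A ∣ ≡ Subset χ
    decode χ = Inverse.to (proj₂ (fibre-small (Subset χ)))

    bound : ∀ {χ} {X : Set ℓ} → X ≡ Subset χ → X ↣ Λ
    bound {χ} refl = mk↣ (Subset-≡ {χ})

    decodeBounded : Code → BoundedStructure K Λ
    decodeBounded (χ , i) = proj₁ (decode χ i) , [ bound (proj₂ (decode χ i)) ]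

  essentiallySmall : SmallModel (restriction K Λ)
  essentiallySmall = record
    { small         = FullSubcategory (restriction K Λ) decodeBounded
    ; inclusion     = record
        { F₀ = decodeBounded ; F₁ = idᶠ ; identity = refl ; homomorphism = λ _ _ → refl }
    ; isEquivalence = record
        { fullyFaithful         = idᶠ , λ f → f , idᶠ
        ; essentiallySurjective = λ { (A , [ i ]) → encode A (recompute em i) }
        }
    }
    where
    encode : ∀ A (i : ∣ A ∣ ↣ Λ) → Σ Code λ c → Iso category (value (decodeBounded c)) A
    encode A i =
      let (Aσ , (f , g , gf≡id , fg≡id) , eq , _) = transport A σ
          open Inverse (proj₂ (fibre-small (Subset χ)))
      in (χ , from (Aσ , eq)) ,
         subst (λ B → Iso category B A) (sym (cong proj₁ (strictlyInverseˡ (Aσ , eq))))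
               (g , f , fg≡id , gf≡id)
      where
      module i = Injection i
      Image : Λ → Set ℓ
      Image x = Σ ∣ A ∣ λ a → i.to a ≡ x
      χ : Λ → Bool
      χ x = isYes (em {P = Image x})
      σ : ∣ A ∣ ⤖ Subset χ
      σ = mk⤖ {to = λ a → i.to a , fromWitness {a? = em {P = Image (i.to a)}} (a , refl)}
        ( (λ e → i.injective (cong proj₁ e))
        , λ { (x , t) → let (a , e) = toWitness {a? = em {P = Image x}} t
                        in a , λ { refl → Subset-≡ e } } )

{-# OPTIONS --safe #-}

-- For the atomic topology a morphism of sheaves is epi exactly when it is
-- locally surjective, since the two-element constant presheaf is a sheaf and
-- classifies local images.
--
-- If M is maximal, then every arrow out of M is invertible, so an element of
-- X^Z at M is the same as an arbitrary function Z(M) → X(M), and an epi is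
-- surjective at M. Hence every element of Y^Z at M lifts along g^Z.
--
-- Conversely, choose for each c an arrow c → c⁺ that is invertible only if c
-- is maximal. The sum over all c of the representables of c⁺ maps epimorphically
-- to the sum Y of the representables of c. Choice, applied to Y^Y and its
-- identity element at A, extends A to some d over which this epi is split; the
-- splitting evaluated at the identity of d is a retraction of d → d⁺, which is
-- therefore invertible because all arrows are monic.

module Submission where

open import Defs
open import Data.Bool using (Bool; true)
open import Data.Product using (Σ; _×_; _,_; proj₁; proj₂)
open import Data.Product.Properties.WithK using (,-injectiveʳ)
open import Data.Unit.Polymorphic using (⊤; tt)
open import Function.Base using () renaming (_∘_ to _∘ᶠ_)
open import Function.Bundles using (_⇔_; mk⇔)
open import Function.Construct.Composition using (_⇔-∘_)
open import Function.Definitions using (Injective)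
open import Level using (Level; Lift; lift; lower)
open import Relation.Binary.PropositionalEquality
  using (_≡_; refl; sym; trans; cong; cong₂; cong-app; subst; module ≡-Reasoning)
open import Relation.Nullary using (¬_; yes; no)
open import Relation.Nullary.Decidable using (decidable-stable; isYes)

private
  variable
    o h ℓ : Level

-- Cancelling isomorphisms from composites.

module _ (C : Category o h) where
  open Category C
  open ≡-Reasoning

  cancelInner : ∀ {A B D E} {a : Hom D E} {i : Hom B D} {j : Hom D B} {b : Hom A D} →
                i ∘ j ≡ id → (a ∘ i) ∘ (j ∘ b) ≡ a ∘ b
  cancelInner {a = a} {i} {j} {b} ij≡id = begin
    (a ∘ i) ∘ (j ∘ b) ≡⟨ assoc a i (j ∘ b) ⟩
    a ∘ (i ∘ (j ∘ b)) ≡⟨ cong (a ∘_) (assoc i j b) ⟨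
    a ∘ ((i ∘ j) ∘ b) ≡⟨ cong (λ k → a ∘ (k ∘ b)) ij≡id ⟩
    a ∘ (id ∘ b)      ≡⟨ cong (a ∘_) (identityˡ b) ⟩
    a ∘ b             ∎

  isIso-cancelʳ : ∀ {A B D} (f : Hom B D) {i : Hom A B} →
                  IsIso C i → IsIso C (f ∘ i) → IsIso C f
  isIso-cancelʳ f {i} (j , ji≡id , ij≡id) (k , kfi≡id , fik≡id) =
    i ∘ k ,
    (begin
      (i ∘ k) ∘ f             ≡⟨ cong ((i ∘ k) ∘_) (trans (sym (identityʳ f)) (cong (f ∘_) (sym ij≡id))) ⟩
      (i ∘ k) ∘ (f ∘ (i ∘ j)) ≡⟨ cong ((i ∘ k) ∘_) (assoc f i j) ⟨
      (i ∘ k) ∘ ((f ∘ i) ∘ j) ≡⟨ cancelInner kfi≡id ⟩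
      i ∘ j                   ≡⟨ ij≡id ⟩
      id                      ∎) ,
    trans (sym (assoc f i k)) fik≡id

  isIso-cancelˡ : ∀ {A B D} {i : Hom B D} (f : Hom A B) →
                  IsIso C i → IsIso C (i ∘ f) → IsIso C f
  isIso-cancelˡ {i = i} f (j , ji≡id , ij≡id) (k , kif≡id , ifk≡id) =
    k ∘ i ,
    trans (assoc k i f) kif≡id ,
    (begin
      f ∘ (k ∘ i)             ≡⟨ cong (_∘ (k ∘ i)) (trans (sym (identityˡ f)) (cong (_∘ f) (sym ji≡id))) ⟩
      ((j ∘ i) ∘ f) ∘ (k ∘ i) ≡⟨ cong (_∘ (k ∘ i)) (assoc j i f) ⟩
      (j ∘ (i ∘ f)) ∘ (k ∘ i) ≡⟨ cancelInner ifk≡id ⟩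
      j ∘ i                   ≡⟨ ji≡id ⟩
      id                      ∎)

-- Invariance of maximal extensions under passage to a small model.

module _ {D : Category o ℓ} (E : SmallModel D) where
  open SmallModel E
  open Functor inclusion
  open IsEquivalence isEquivalence
  private
    module C = Category small
    module D = Category D

    preimage : ∀ {A B} (k : D.Hom (F₀ A) (F₀ B)) → Σ (C.Hom A B) λ f → F₁ f ≡ k
    preimage k = let (f , e) = proj₂ fullyFaithful k in f , e refl

  isIso-preserved : ∀ {A B} {f : C.Hom A B} → IsIso small f → IsIso D (F₁ f)
  isIso-preserved {f = f} (g , gf≡id , fg≡id) =
    F₁ g ,
    trans (sym (homomorphism g f)) (trans (cong F₁ gf≡id) identity) ,
    trans (sym (homomorphism f g)) (trans (cong F₁ fg≡id) identity)

  isIso-reflected : ∀ {A B} {f : C.Hom A B} → IsIso D (F₁ f) → IsIso small f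
  isIso-reflected {f = f} (g , gf≡id , fg≡id) with preimage g
  ... | g′ , refl =
    g′ ,
    proj₁ fullyFaithful (trans (homomorphism g′ f) (trans gf≡id (sym identity))) ,
    proj₁ fullyFaithful (trans (homomorphism f g′) (trans fg≡id (sym identity)))

  maximalExtension-small : MaximalExtensionProperty D ⇔ MaximalExtensionProperty small
  maximalExtension-small = mk⇔ to from
    where
    to : MaximalExtensionProperty D → MaximalExtensionProperty small
    to mep c =
      let (M , f , max)    = mep (F₀ c)
          (m , i , iso-i)  = essentiallySurjective M
          (j , ji≡id , ij≡id) = iso-i
      in m , proj₁ (preimage (j D.∘ f)) , λ k →
         -- Composing with `j` turns `F₁ k` into an arrow out of the maximal `M`.
         isIso-reflected (isIso-cancelʳ D (F₁ k) (i , ij≡id , ji≡id) (max (F₁ k D.∘ j)))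

    from : MaximalExtensionProperty small → MaximalExtensionProperty D
    from mep A =
      let (a , _ , j , _)  = essentiallySurjective A
          (m , f , max)    = mep a
      in F₀ m , F₁ f D.∘ j , λ {B} k →
         let (b , i , l , li≡id , il≡id) = essentiallySurjective B
             (k′ , F₁k′≡lk)              = preimage (l D.∘ k)
         -- Up to the isomorphism `l`, the arrow `k` is the image of `k′`, which leaves the maximal
         -- `m`.
         in isIso-cancelˡ D k (i , il≡id , li≡id)
              (subst (IsIso D) F₁k′≡lk (isIso-preserved (max k′)))

-- Sheaves for the atomic topology.

module AtomicTopos (cl : Classical) (S : Category ℓ ℓ) (ap : AmalgamationProperty S) where
  open Classical cl
  open Category S
  open ≡-Reasoning
  open NatTrans
  open Sheaf

  J : GrothendieckTopology (op S)
  J = atomicTopology S ap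

  open SheafTopos ext (op S) J public

  private
    _at_ : Sheaf (op S) J → Obj → Set ℓ
    X at c = Functor.F₀ (presheaf X) c

    act : (X : Sheaf (op S) J) → ∀ {c d} → Hom c d → X at c → X at d
    act X = Functor.F₁ (presheaf X)

    act-∘ : (X : Sheaf (op S) J) → ∀ {b c d} (g : Hom c d) (f : Hom b c) (x : X at b) →
            act X (g ∘ f) x ≡ act X g (act X f x)
    act-∘ X g f = cong-app (Functor.homomorphism (presheaf X) g f)

    act-id : (X : Sheaf (op S) J) → ∀ {c} (x : X at c) → act X id x ≡ x
    act-id X = cong-app (Functor.identity (presheaf X))

    act-cancel : (X : Sheaf (op S) J) → ∀ {c d} {g : Hom d c} {f : Hom c d} →
                 g ∘ f ≡ id → (x : X at c) → act X g (act X f x) ≡ x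
    act-cancel X {g = g} {f} gf≡id x =
      trans (sym (act-∘ X g f x)) (trans (cong (λ k → act X k x) gf≡id) (act-id X x))

    natural : {X Y : Sheaf (op S) J} (α : Category.Hom Sh X Y) → ∀ {c d} (f : Hom c d) (x : X at c) →
              η α d (act X f x) ≡ act Y f (η α c x)
    natural α f = cong-app (commute α f)

  -- A single arrow already generates a covering sieve. Both `x` and `x′` amalgamate the orbit of
  -- `x` on the sieve generated by `f`, and amalgamations are unique.
  act-injective : (X : Sheaf (op S) J) → ∀ {c d} (f : Hom c d) → Injective _≡_ _≡_ (act X f)
  act-injective X {c} {d} f {x} {x′} fx≡fx′ =
    trans (sym (unique λ _ _ → refl)) (unique agree)
    where
    principal : Sieve (op S) c
    principal = generatedSieve (op S) record { Index = ⊤ ; source = λ _ → d ; arrow = λ _ → f }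

    orbit : MatchingFamily (op S) (presheaf X) principal
    orbit = record
      { section    = λ k _ → act X k x
      ; compatible = λ k _ g _ → act-∘ X g k x
      }

    unique : ∀ {b} → IsAmalgamation (op S) (presheaf X) orbit b → _ ≡ b
    unique = proj₂ (proj₂ (isSheaf X principal (d , f , tt , id , sym (identityˡ f)) orbit))

    agree : IsAmalgamation (op S) (presheaf X) orbit x′
    agree _ (_ , g , refl) = begin
      act X (g ∘ f) x′      ≡⟨ act-∘ X g f x′ ⟩
      act X g (act X f x′)  ≡⟨ cong (act X g) fx≡fx′ ⟨
      act X g (act X f x)   ≡⟨ act-∘ X g f x ⟨
      act X (g ∘ f) x       ∎

  -- A natural transformation mentions only the presheaves of its endpoints, so
  -- sheaves cannot be inferred from morphisms and are passed explicitly throughout.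

  LocallySurjective : {X Y : Sheaf (op S) J} → Category.Hom Sh X Y → Set ℓ
  LocallySurjective {X} {Y} g =
    ∀ {c} (y : Y at c) → Σ Obj λ d → Σ (Hom c d) λ f → Σ (X at d) λ x → η g d x ≡ act Y f y

  -- `u` and `v` agree at `act Y f y`, which comes from `X`; injectivity of `act D f` then removes
  -- `f`.
  locallySurjective⇒epi : {X Y : Sheaf (op S) J} (g : Category.Hom Sh X Y) →
                          LocallySurjective {X} {Y} g → Epi Sh {X} {Y} g
  locallySurjective⇒epi {X} {Y} g surj {D} u v ug≡vg = NatTrans-≡ ext λ c → ext λ y →
    let (d , f , x , gx≡fy) = surj y in act-injective D f (begin
      act D f (η u c y)  ≡⟨ natural {Y} {D} u f y ⟨
      η u d (act Y f y)  ≡⟨ cong (η u d) gx≡fy ⟨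
      η u d (η g d x)    ≡⟨ cong (λ α → η α d x) ug≡vg ⟩
      η v d (η g d x)    ≡⟨ cong (η v d) gx≡fy ⟩
      η v d (act Y f y)  ≡⟨ natural {Y} {D} v f y ⟩
      act D f (η v c y)  ∎)

  -- Coproducts of sheaves.

  coproductPresheaf : (I : Set ℓ) → (I → Presheaf (op S)) → Presheaf (op S)
  coproductPresheaf I P = record
    { F₀           = λ c → Σ I λ i → Functor.F₀ (P i) c
    ; F₁           = λ { f (i , x) → i , Functor.F₁ (P i) f x }
    ; identity     = ext λ { (i , x) → cong (i ,_) (cong-app (Functor.identity (P i)) x) }
    ; homomorphism = λ g f → ext λ { (i , x) → cong (i ,_) (cong-app (Functor.homomorphism (P i) g f) x) }
    }

  -- Any two arrows of a sieve can be amalgamated, so the index of the sections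
  -- of a matching family is constant: no sheafification is needed.

  module CoproductIsSheaf (I : Set ℓ) (X : I → Sheaf (op S) J) {c : Obj} (R : Sieve (op S) c)
           {d₀ : Obj} (f₀ : Hom c d₀) (p₀ : Sieve.arrows R f₀)
           (m : MatchingFamily (op S) (coproductPresheaf I (presheaf ∘ᶠ X)) R) where
    open Sieve R
    open MatchingFamily m
    open Functor (coproductPresheaf I (presheaf ∘ᶠ X)) using (F₁)

    i₀ : I
    i₀ = proj₁ (section f₀ p₀)

    index-constant : ∀ {d} (f : Hom c d) (p : arrows f) → proj₁ (section f p) ≡ i₀
    index-constant f p =
      let (e , u , v , uf≡vf₀) = ap f f₀ in
      cong proj₁ (trans (sym (compatible f p u (closed u p))) (restrict uf≡vf₀ (closed u p)))
      where
      restrict : ∀ {e} {k : Hom c e} {v : Hom d₀ e} → k ≡ v ∘ f₀ → (q : arrows k) →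
                 section k q ≡ F₁ v (section f₀ p₀)
      restrict refl q = compatible f₀ p₀ _ q

    component : ∀ {d} (f : Hom c d) (p : arrows f) →
                Σ (X i₀ at d) λ x → section f p ≡ (i₀ , x)
    component f p = split (section f p) (index-constant f p)
      where
      split : ∀ {d} (s : Σ I λ i → X i at d) → proj₁ s ≡ i₀ → Σ (X i₀ at d) λ x → s ≡ (i₀ , x)
      split (_ , x) refl = x , refl

    componentFamily : MatchingFamily (op S) (presheaf (X i₀)) R
    componentFamily = record
      { section    = λ f p → proj₁ (component f p)
      ; compatible = λ f p g q → ,-injectiveʳ
          (trans (sym (proj₂ (component (g ∘ f) q)))
                 (trans (compatible f p g q) (cong (F₁ g) (proj₂ (component f p)))))
      }

    glued = isSheaf (X i₀) R (d₀ , f₀ , p₀) componentFamily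

    isAmalgamation : IsAmalgamation (op S) (coproductPresheaf I (presheaf ∘ᶠ X)) m (i₀ , proj₁ glued)
    isAmalgamation f p =
      trans (cong (i₀ ,_) (proj₁ (proj₂ glued) f p)) (sym (proj₂ (component f p)))

    isUnique : ∀ {b} → IsAmalgamation (op S) (coproductPresheaf I (presheaf ∘ᶠ X)) m b →
               (i₀ , proj₁ glued) ≡ b
    -- The action preserves indices, so comparing with the section at `f₀` forces the index of any
    -- amalgamation to be `i₀`.
    isUnique {_ , b} q with refl ← cong proj₁ (q f₀ p₀) =
      cong (i₀ ,_) (proj₂ (proj₂ glued) λ f p → ,-injectiveʳ (trans (q f p) (proj₂ (component f p))))

  coproduct : (I : Set ℓ) → (I → Sheaf (op S) J) → Sheaf (op S) J
  coproduct I X = sheaf (coproductPresheaf I (presheaf ∘ᶠ X)) λ { R (_ , f₀ , p₀) m →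
    let open CoproductIsSheaf I X R f₀ p₀ m in (i₀ , proj₁ glued) , isAmalgamation , isUnique }

  terminal : Sheaf (op S) J
  terminal = sheaf
    (record { F₀ = λ _ → ⊤ ; F₁ = λ _ x → x ; identity = refl ; homomorphism = λ _ _ → refl })
    (λ _ _ _ → tt , (λ _ _ → refl) , (λ _ → refl))

  -- Images of sheaf morphisms, and local surjectivity of epimorphisms.

  module _ {X Y : Sheaf (op S) J} (g : Category.Hom Sh X Y) where

    -- The sheaf image of `g`: one arrow carrying `y` into the presheaf image suffices, since one
    -- arrow generates a cover.
    InLocalImage : ∀ {c} → Y at c → Set ℓ
    InLocalImage {c} y = Σ Obj λ d → Σ (Hom c d) λ f → Σ (X at d) λ x → η g d x ≡ act Y f y

    -- Amalgamating the witness `f` with `k` moves the preimage to a common extension.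
    localImage-act : ∀ {c d} (k : Hom c d) {y : Y at c} → InLocalImage y → InLocalImage (act Y k y)
    localImage-act k {y} (d , f , x , gx≡fy) =
      let (e , u , v , uf≡vk) = ap f k in
      e , v , act X u x , (begin
        η g e (act X u x)    ≡⟨ natural {X} {Y} g u x ⟩
        act Y u (η g d x)    ≡⟨ cong (act Y u) gx≡fy ⟩
        act Y u (act Y f y)  ≡⟨ act-∘ Y u f y ⟨
        act Y (u ∘ f) y      ≡⟨ cong (λ l → act Y l y) uf≡vk ⟩
        act Y (v ∘ k) y      ≡⟨ act-∘ Y v k y ⟩
        act Y v (act Y k y)  ∎)

    localImage-act⁻¹ : ∀ {c d} (k : Hom c d) {y : Y at c} → InLocalImage (act Y k y) → InLocalImage y
    localImage-act⁻¹ k {y} (d , f , x , gx≡fky) = d , f ∘ k , x , trans gx≡fky (sym (act-∘ Y f k y))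

    private
      truth : ∀ {P Q : Set ℓ} → (P → Q) → (Q → P) → isYes (em {P = P}) ≡ isYes (em {P = Q})
      truth {P} {Q} to from with em {P = P} | em {P = Q}
      ... | yes _ | yes _ = refl
      ... | yes p | no ¬q with () ← ¬q (to p)
      ... | no ¬p | yes q with () ← ¬p (from q)
      ... | no _  | no _  = refl

      two : Sheaf (op S) J
      two = coproduct (Lift ℓ Bool) λ _ → terminal

      -- The characteristic map of the image. Two constant truth values suffice because the action
      -- both preserves and reflects membership.
      χ : Category.Hom Sh Y two
      χ = record
        { η       = λ _ y → lift (isYes (em {P = InLocalImage y})) , tt
        ; commute = λ k → ext λ y →
            cong (λ b → lift b , tt) (truth (localImage-act⁻¹ k) (localImage-act k))
        }

      always : Category.Hom Sh Y two
      always = record { η = λ _ _ → lift true , tt ; commute = λ _ → refl }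

      isYes-true : ∀ {P : Set ℓ} → P → isYes (em {P = P}) ≡ true
      isYes-true {P} p with em {P = P}
      ... | yes _ = refl
      ... | no ¬p with () ← ¬p p

      true-isYes : ∀ {P : Set ℓ} → isYes (em {P = P}) ≡ true → P
      true-isYes {P} e with yes p ← em {P = P} = p

    epi⇒locallySurjective : Epi Sh {X} {Y} g → LocallySurjective {X} {Y} g
    epi⇒locallySurjective epi {c} y = true-isYes (cong (λ α → lower (proj₁ (η α c y))) χ≡always)
      where
      χ≡always : χ ≡ always
      -- Values of `g` lie in the image with witness `id`, so the two maps agree after `g`.
      χ≡always = epi {two} χ always (NatTrans-≡ ext λ d → ext λ x →
        cong (λ b → lift b , tt) (isYes-true (d , id , x , sym (act-id Y (η g d x)))))

  -- From maximal extensions to choice.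

  open Exponentials exponentials using (_^_; _^₁_)

  module _ {X Y : Sheaf (op S) J} (g : Category.Hom Sh X Y) (surj : LocallySurjective {X} {Y} g)
           {M : Obj} (max : IsMaximal S M) where
    private
      inv : ∀ {d} → Hom M d → Hom d M
      inv f = proj₁ (max f)

    -- A lift exists after some arrow `f` out of `M`; acting by the inverse of `f` brings it back to
    -- `M`.
    surjective-at-maximal : (y : Y at M) → Σ (X at M) λ x → η g M x ≡ y
    surjective-at-maximal y =
      let (d , f , x , gx≡fy) = surj y in
      act X (inv f) x , (begin
        η g M (act X (inv f) x)      ≡⟨ natural {X} {Y} g (inv f) x ⟩
        act Y (inv f) (η g d x)      ≡⟨ cong (act Y (inv f)) gx≡fy ⟩
        act Y (inv f) (act Y f y)    ≡⟨ act-cancel Y (proj₁ (proj₂ (max f))) y ⟩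
        y                            ∎)

    module _ (Z : Sheaf (op S) J) where

      -- Transports `s` along the isomorphism `f`. Equivariance of `s` under automorphisms of `M` is
      -- not demanded, because the argument `f` records which isomorphism is used.
      atMaximal : (Z at M → X at M) → (X ^ Z) at M
      atMaximal s = record
        { η       = λ { d (f , z) → act X f (s (act Z (inv f) z)) }
        ; commute = λ u → ext λ { (f , z) → begin
            act X (u ∘ f) (s (act Z (inv (u ∘ f)) (act Z u z)))
              -- Writing `z` as `act Z f (act Z (inv f) z)` lets `u` and `f` merge into `u ∘ f`,
              -- which `inv (u ∘ f)` cancels.
              ≡⟨ cong (λ w → act X (u ∘ f) (s (act Z (inv (u ∘ f)) (act Z u w))))
                      (act-cancel Z (proj₂ (proj₂ (max f))) z) ⟨
            act X (u ∘ f) (s (act Z (inv (u ∘ f)) (act Z u (act Z f (act Z (inv f) z)))))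
              ≡⟨ cong (λ w → act X (u ∘ f) (s (act Z (inv (u ∘ f)) w))) (act-∘ Z u f _) ⟨
            act X (u ∘ f) (s (act Z (inv (u ∘ f)) (act Z (u ∘ f) (act Z (inv f) z))))
              ≡⟨ cong (λ w → act X (u ∘ f) (s w)) (act-cancel Z (proj₁ (proj₂ (max (u ∘ f)))) _) ⟩
            act X (u ∘ f) (s (act Z (inv f) z))
              ≡⟨ act-∘ X u f _ ⟩
            act X u (act X f (s (act Z (inv f) z))) ∎ }
        }

      exponential-surjective-at-maximal :
        (φ : (Y ^ Z) at M) → Σ ((X ^ Z) at M) λ ψ → η (_^₁_ {X} {Y} g Z) M ψ ≡ φ
      exponential-surjective-at-maximal φ = atMaximal s , NatTrans-≡ ext λ d → ext λ { (f , z) → begin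
        η g d (act X (id ∘ f) (s (act Z (inv (id ∘ f)) z)))
          ≡⟨ cong (λ k → η g d (act X k (s (act Z (inv k) z)))) (identityˡ f) ⟩
        η g d (act X f (s (act Z (inv f) z)))
          ≡⟨ natural {X} {Y} g f _ ⟩
        act Y f (η g M (s (act Z (inv f) z)))
          ≡⟨ cong (act Y f) (proj₂ (surjective-at-maximal _)) ⟩
        act Y f (η φ M (id , act Z (inv f) z))
          ≡⟨ cong-app (commute φ f) (id , act Z (inv f) z) ⟨
        η φ d (f ∘ id , act Z f (act Z (inv f) z))
          ≡⟨ cong₂ (λ k w → η φ d (k , w)) (identityʳ f) (act-cancel Z (proj₂ (proj₂ (max f))) z) ⟩
        η φ d (f , z) ∎ }
        where
        s : Z at M → X at M
        -- Preimages are chosen separately for each `z`, with no coherence between the choices.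
        s z = proj₁ (surjective-at-maximal (η φ M (id , z)))

  maximalExtension⇒choice : MaximalExtensionProperty S → InternalAxiomOfChoice Sh products exponentials
  maximalExtension⇒choice mep {X} {Y} g epi Z {D} = locallySurjective⇒epi {X ^ Z} {Y ^ Z} (_^₁_ {X} {Y} g Z)
    (λ {c} φ →
      -- Local surjectivity permits moving `φ` to a maximal `M` before lifting it.
      let (M , f , max) = mep c
          (ψ , e)       = exponential-surjective-at-maximal {X} {Y} g surj {M} max Z (act (Y ^ Z) f φ)
      in M , f , ψ , e) {D}
    where
    surj : LocallySurjective {X} {Y} g
    surj = epi⇒locallySurjective {X} {Y} g λ {D} → epi {D}

  -- From choice to maximal extensions.

  choice⇒locallySplit : InternalAxiomOfChoice Sh products exponentials →
                        {X Y : Sheaf (op S) J} (g : Category.Hom Sh X Y) → Epi Sh {X} {Y} g → ∀ A →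
                        Σ Obj λ d → Hom A d × Σ (Y at d → X at d) λ s → ∀ y → η g d (s y) ≡ y
  choice⇒locallySplit iac {X} {Y} g epi A =
    -- Lifting the name of the identity of `Y` along `g ^₁ Y` yields an internal section `ψ` of `g`
    -- at some `d` over `A`.
    let (d , f , ψ , gψ≡f) = epi⇒locallySurjective {X ^ Y} {Y ^ Y} (_^₁_ {X} {Y} g Y)
                               (λ {D} → iac {X} {Y} g (λ {D} → epi {D}) Y {D}) {A} identityElement
    -- `id ∘ id` is the arrow at which `g ^₁ Y` evaluates `ψ` when its value is taken at `id`, so
    -- the equation needs no rewriting.
    in d , f , (λ y → η ψ d (id ∘ id , y)) , λ y → cong (λ (φ : (Y ^ Y) at d) → η φ d (id , y)) gψ≡f
    where
    identityElement : (Y ^ Y) at A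
    identityElement = record { η = λ _ → proj₂ ; commute = λ _ → refl }

  module _ (subcanonical : Subcanonical (op S) J ext) where

    y : Obj → Sheaf (op S) J
    y c = sheaf (representable (op S) ext c) (subcanonical c)

    -- Postcomposition with `k` is the action on a representable, which is a sheaf by subcanonicity;
    -- hence `k` is monic, and a monic split epi is invertible.
    retraction⇒isIso : ∀ {c d} (f : Hom c d) (k : Hom d c) → k ∘ f ≡ id → IsIso S f
    retraction⇒isIso {c} {d} f k kf≡id = k , kf≡id , act-injective (y d) k (begin
      k ∘ (f ∘ k)  ≡⟨ assoc k f k ⟨
      (k ∘ f) ∘ k  ≡⟨ cong (_∘ k) kf≡id ⟩
      id ∘ k       ≡⟨ identityˡ k ⟩
      k            ≡⟨ identityʳ k ⟨
      k ∘ id       ∎)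

    -- The test arrow is non-invertible if `c` has such an arrow, making the implication vacuous;
    -- otherwise it is `id` and `c` is maximal outright.
    maximalityTest : ∀ c → Σ Obj λ c⁺ → Σ (Hom c c⁺) λ f → IsIso S f → IsMaximal S c
    maximalityTest c with em {P = Σ Obj λ d → Σ (Hom c d) λ f → ¬ IsIso S f}
    ... | yes (d , f , ¬iso) = d , f , λ iso → λ _ → decidable-stable em λ _ → ¬iso iso
    ... | no ¬nonIso         = c , id , λ _ {d} f → decidable-stable em λ ¬iso → ¬nonIso (d , f , ¬iso)

    private
      _⁺ : Obj → Obj
      c ⁺ = proj₁ (maximalityTest c)

      extend : ∀ c → Hom c (c ⁺)
      extend c = proj₁ (proj₂ (maximalityTest c))

      Y⁺ Y : Sheaf (op S) J
      Y⁺ = coproduct Obj λ c → y (c ⁺)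
      Y  = coproduct Obj y

      -- On each summand this is the Yoneda image of `extend c`. Summing over all `c` tests every
      -- object at once, as the `d` to be tested emerges only once choice has been applied.
      restrict : Category.Hom Sh Y⁺ Y
      restrict = record
        { η       = λ { _ (c , k) → c , k ∘ extend c }
        ; commute = λ f → ext λ { (c , k) → cong (c ,_) (assoc f k (extend c)) }
        }

      restrict-epi : Epi Sh {Y⁺} {Y} restrict
      restrict-epi {D} = locallySurjective⇒epi {Y⁺} {Y} restrict (λ { (c , k) →
        -- Once amalgamated with `extend c`, the arrow `k` factors through `extend c`.
        let (d , u , v , u-extend≡vk) = ap (extend c) k in
        d , v , (c , u) , cong (c ,_) u-extend≡vk }) {D}

      split⇒maximal : ∀ {c d} {k : Hom (c ⁺) d} →
                      -- Equality in the sum identifies `c` with `d`, so `k` becomes a retraction of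
                      -- `extend d`.
                      _≡_ {A = Σ Obj λ c → Hom c d} (c , k ∘ extend c) (d , id) → IsMaximal S d
      split⇒maximal {c} {d} {k} e with refl ← cong proj₁ e =
        proj₂ (proj₂ (maximalityTest d)) (retraction⇒isIso (extend d) k (,-injectiveʳ e))

    choice⇒maximalExtension : InternalAxiomOfChoice Sh products exponentials → MaximalExtensionProperty S
    choice⇒maximalExtension iac A =
      let (d , f , section , splits) = choice⇒locallySplit
            (λ {X} {Y} → iac {X} {Y}) {Y⁺} {Y} restrict (λ {D} → restrict-epi {D}) A
      -- The splitting is evaluated at the universal element `id` of the summand indexed by `d`
      -- itself.
      in d , f , split⇒maximal (splits (d , id))

    maximalExtension⇔choice : MaximalExtensionProperty S ⇔ InternalAxiomOfChoice Sh products exponentials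
    maximalExtension⇔choice = mk⇔ maximalExtension⇒choice choice⇒maximalExtension

-- The equivalence for structures bounded by `Λ`, by transfer from the small model.

theorem6p2 : (cl : Classical) → let open Classical cl in
    ∀ {o ℓ : Level} (Λ : Set ℓ) → Infinite Λ →
    (K : StructureClass o ℓ) (E : SmallModel (restriction K Λ)) →
    (apc : IsSubcanonicalAPClass K Λ E ext) →
    let open SmallModel E
        open IsSubcanonicalAPClass apc
        open SheafTopos ext (op small) J-at
    in MaximalExtensionProperty (restriction K Λ) ⇔
       InternalAxiomOfChoice Sh products exponentials
theorem6p2 cl Λ _ K E apc =
  AtomicTopos.maximalExtension⇔choice cl (SmallModel.small E)
    (AP-small E λ {A} {B} {C} → amalgamation {A} {B} {C}) subcanonical
  ⇔-∘ maximalExtension-small E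
  where open IsSubcanonicalAPClass apc
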